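{- For all $P,Q\in C_A$, $P=_{mse}Q$ if and only if $P=_{mbf}Q$; that is, $mse(P)=mse(Q)$ if and only if $mbf(P)=mbf(Q)$.
   Context: Let $A$ be a countable set (of atoms) with at least two elements. $C_A$ is the set of closed terms (conditional statements) over the signature with constants $T$, $F$, a constant $a$ for each $a\in A$, and one ternary operation $x\triangleleft y\triangleright z$ (the conditional, "if $y$ then $x$ else $z$"). Evaluation trees: the set $\mathcal T_A$ is defined inductively by $T\in\mathcal T_A$, $F\in\mathcal T_A$, and $(X\trianglelefteq a\trianglerighteq Y)\in\mathcal T_A$ for all $X,Y\in\mathcal T_A$, $a\in A$ (binary tree with root $a$, left branch $X$, right branch $Y$). Leaf replacement: for $Y,Z\in\mathcal T_A$, $X[T\mapsto Y,F\mapsto Z]$ is defined by $T[T\mapsto Y,F\mapsto Z]=Y$, $F[T\mapsto Y,F\mapsto Z]=Z$, $(X_1\trianglelefteq a\trianglerighteq X_2)[T\mapsto Y,F\mapsto Z]=X_1[T\mapsto Y,F\mapsto Z]\trianglelefteq a\trianglerighteq X_2[T\mapsto Y,F\mapsto Z]$. The short-circuit evaluation function $se:C_A\to\mathcal T_A$ is defined by $se(T)=T$, $se(F)=F$, $se(a)=T\trianglelefteq a\trianglerighteq F$ for $a\in A$, and $se(P\triangleleft Q\triangleright R)=se(Q)[T\mapsto se(P),F\mapsto se(R)]$. Memorizing evaluation trees: for $a\in A$ define $L_a,R_a:\mathcal T_A\to\mathcal T_A$ by $L_a(B)=R_a(B)=B$ for $B\in\{T,F\}$; $L_a(X\trianglelefteq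 a\trianglerighteq Y)=L_a(X)$; $R_a(X\trianglelefteq a\trianglerighteq Y)=R_a(Y)$; and, if $b\neq a$, $L_a(X\trianglelefteq b\trianglerighteq Y)=L_a(X)\trianglelefteq b\trianglerighteq L_a(Y)$ and $R_a(X\trianglelefteq b\trianglerighteq Y)=R_a(X)\trianglelefteq b\trianglerighteq R_a(Y)$. Define $m:\mathcal T_A\to\mathcal T_A$ (by recursion on depth) by $m(T)=T$, $m(F)=F$, $m(X\trianglelefteq a\trianglerighteq Y)=m(L_a(X))\trianglelefteq a\trianglerighteq m(R_a(Y))$. Then $mse:C_A\to\mathcal T_A$ is $mse(P)=m(se(P))$, and $P=_{mse}Q$ iff $mse(P)=mse(Q)$. Basic forms: $BF_A\subseteq C_A$ is given by the grammar $t::=T\mid F\mid t\triangleleft a\triangleright t$ ($a\in A$). For $P,Q,R\in BF_A$, $P[T\mapsto Q,F\mapsto R]\in BF_A$ is obtained by replacing all occurrences of $T$ in $P$ by $Q$ and all occurrences of $F$ in $P$ by $R$ (simultaneously). The basic form function $bf:C_A\to BF_A$ is defined by $bf(T)=T$, $bf(F)=F$, $bf(a)=T\triangleleft a\triangleright F$ for $a\in A$, $bf(P\triangleleft Q\triangleright R)=bf(Q)[T\mapsto bf(P),F\mapsto bf(R)]$. The function $mbf$: for $a\in A$ define $\ell_a,r_a:BF_A\to BF_A$ by $\ell_a(B)=r_a(B)=B$ for $B\in\{T,F\}$; $\ell_a(P\triangleleft a\triangleright Q)=\ell_a(P)$; $r_a(P\triangleleft a\triangleright Q)=r_a(Q)$;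 and, if $b\neq a$, $\ell_a(P\triangleleft b\triangleright Q)=\ell_a(P)\triangleleft b\triangleright \ell_a(Q)$ and $r_a(P\triangleleft b\triangleright Q)=r_a(P)\triangleleft b\triangleright r_a(Q)$. Define $mf:BF_A\to BF_A$ (by recursion on depth) by $mf(T)=T$, $mf(F)=F$, $mf(P\triangleleft a\triangleright Q)=mf(\ell_a(P))\triangleleft a\triangleright mf(r_a(Q))$. Then $mbf(P)=mf(bf(P))$ for $P\in C_A$, and $P=_{mbf}Q$ iff $mbf(P)=mbf(Q)$ (syntactic equality). -}

module Defs where

open import Level using (Level)
open import Data.Bool using (true; false; if_then_else_)
open import Data.Nat using (ℕ; zero; suc; _⊔_; _≤_; z≤n; s≤s)
import Data.Nat.Properties as ℕ
open import Data.Product using (Σ; _,_; proj₁)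
open import Function.Bundles using (_↣_)
open import Relation.Binary.Definitions using (DecidableEquality)
open import Relation.Binary.PropositionalEquality using (_≡_; refl; cong₂)
open import Relation.Nullary using (does; yes; no)
open import Relation.Nullary.Decidable using (via-injection)

private
  variable
    ℓ₀ : Level
    A  : Set ℓ₀

-- Finite sets count as countable.
Countable : Set ℓ₀ → Set ℓ₀
Countable A = A ↣ ℕ

infix 5 _◁_▷_ _⊴_⊵_

-- C_A; x ◁ y ▷ z reads "if y then x else z".
data Term (A : Set ℓ₀) : Set ℓ₀ where
  T F   : Term A
  atom  : A → Term A
  _◁_▷_ : Term A → Term A → Term A → Term A

data Tree (A : Set ℓ₀) : Set ℓ₀ where
  T F   : Tree A
  _⊴_⊵_ : Tree A → A → Tree A → Tree A

_[T↦_,F↦_] : Tree A → Tree A → Tree A → Tree A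
T             [T↦ Y ,F↦ Z ] = Y
F             [T↦ Y ,F↦ Z ] = Z
(X₁ ⊴ a ⊵ X₂) [T↦ Y ,F↦ Z ] = (X₁ [T↦ Y ,F↦ Z ]) ⊴ a ⊵ (X₂ [T↦ Y ,F↦ Z ])

se : Term A → Tree A
se T           = T
se F           = F
se (atom a)    = T ⊴ a ⊵ F
se (P ◁ Q ▷ R) = se Q [T↦ se P ,F↦ se R ]

depth : Tree A → ℕ
depth T           = 0
depth F           = 0
depth (X ⊴ _ ⊵ Y) = suc (depth X ⊔ depth Y)

-- The grammar t ::= T | F | t ◁ a ▷ t, as a predicate carving BF_A out of C_A.
-- IsBF P has at most one inhabitant, so BF A is a subset of Term A.
data IsBF {A : Set ℓ₀} : Term A → Set ℓ₀ where
  T    : IsBF T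
  F    : IsBF F
  cond : ∀ {P Q} → IsBF P → (a : A) → IsBF Q → IsBF (P ◁ atom a ▷ Q)

BF : Set ℓ₀ → Set ℓ₀
BF A = Σ (Term A) IsBF

condᵇ : BF A → A → BF A → BF A
condᵇ (P , p) a (Q , q) = (P ◁ atom a ▷ Q) , cond p a q

_[T↦_,F↦_]ᵇ : BF A → BF A → BF A → BF A
(_ , T)          [T↦ Q ,F↦ R ]ᵇ = Q
(_ , F)          [T↦ Q ,F↦ R ]ᵇ = R
(_ , cond p a q) [T↦ Q ,F↦ R ]ᵇ =
  condᵇ ((_ , p) [T↦ Q ,F↦ R ]ᵇ) a ((_ , q) [T↦ Q ,F↦ R ]ᵇ)

bf : Term A → BF A
bf T           = T , T
bf F           = F , F
bf (atom a)    = condᵇ (T , T) a (F , F)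
bf (P ◁ Q ▷ R) = bf Q [T↦ bf P ,F↦ bf R ]ᵇ

depthᵇ : BF A → ℕ
depthᵇ (_ , T)          = 0
depthᵇ (_ , F)          = 0
depthᵇ (_ , cond p _ q) = suc (depthᵇ (_ , p) ⊔ depthᵇ (_ , q))

depthᵇ-if : ∀ c {P Q : BF A} {n} →
            depthᵇ P ≤ n → depthᵇ Q ≤ n → depthᵇ (if c then P else Q) ≤ n
depthᵇ-if true  h _ = h
depthᵇ-if false _ h = h

atom-≟ : Countable A → DecidableEquality A
atom-≟ countable = via-injection countable ℕ._≟_

module Memorizing {A : Set ℓ₀} (_≟_ : DecidableEquality A) where

  L R : A → Tree A → Tree A
  L a T = T
  L a F = F
  L a (X ⊴ b ⊵ Y) = if does (b ≟ a) then L a X else (L a X ⊴ b ⊵ L a Y)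
  R a T = T
  R a F = F
  R a (X ⊴ b ⊵ Y) = if does (b ≟ a) then R a Y else (R a X ⊴ b ⊵ R a Y)

  depth-L : ∀ a X → depth (L a X) ≤ depth X
  depth-L a T = z≤n
  depth-L a F = z≤n
  depth-L a (X ⊴ b ⊵ Y) with b ≟ a
  ... | yes _ = ℕ.m≤n⇒m≤1+n (ℕ.m≤n⇒m≤n⊔o (depth Y) (depth-L a X))
  ... | no  _ = s≤s (ℕ.⊔-mono-≤ (depth-L a X) (depth-L a Y))

  depth-R : ∀ a X → depth (R a X) ≤ depth X
  depth-R a T = z≤n
  depth-R a F = z≤n
  depth-R a (X ⊴ b ⊵ Y) with b ≟ a
  ... | yes _ = ℕ.m≤n⇒m≤1+n (ℕ.m≤n⇒m≤o⊔n (depth X) (depth-R a Y))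
  ... | no  _ = s≤s (ℕ.⊔-mono-≤ (depth-R a X) (depth-R a Y))

  -- Recursion on a bound n for the depth; the value does not depend on the
  -- bound (m-bounded-irr), and m-⊴⊵ is the intended defining equation of m.
  m-bounded : ∀ n (X : Tree A) → depth X ≤ n → Tree A
  m-bounded _       T           _       = T
  m-bounded _       F           _       = F
  m-bounded (suc n) (X ⊴ a ⊵ Y) (s≤s h) =
    m-bounded n (L a X) (ℕ.≤-trans (depth-L a X) (ℕ.m⊔n≤o⇒m≤o (depth X) (depth Y) h))
    ⊴ a ⊵
    m-bounded n (R a Y) (ℕ.≤-trans (depth-R a Y) (ℕ.m⊔n≤o⇒n≤o (depth X) (depth Y) h))

  m : Tree A → Tree A
  m X = m-bounded (depth X) X ℕ.≤-refl

  m-bounded-irr : ∀ n n′ X h h′ → m-bounded n X h ≡ m-bounded n′ X h′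
  m-bounded-irr _       _        T           _       _        = refl
  m-bounded-irr _       _        F           _       _        = refl
  m-bounded-irr (suc n) (suc n′) (X ⊴ a ⊵ Y) (s≤s _) (s≤s _) =
    cong₂ (_⊴ a ⊵_) (m-bounded-irr n n′ (L a X) _ _) (m-bounded-irr n n′ (R a Y) _ _)

  m-⊴⊵ : ∀ X a Y → m (X ⊴ a ⊵ Y) ≡ m (L a X) ⊴ a ⊵ m (R a Y)
  m-⊴⊵ X a Y =
    cong₂ (_⊴ a ⊵_) (m-bounded-irr _ _ (L a X) _ _) (m-bounded-irr _ _ (R a Y) _ _)

  mse : Term A → Tree A
  mse P = m (se P)

  ℓ r : A → BF A → BF A
  ℓ a (_ , T) = T , T
  ℓ a (_ , F) = F , F
  ℓ a (_ , cond p b q) =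
    if does (b ≟ a) then ℓ a (_ , p) else condᵇ (ℓ a (_ , p)) b (ℓ a (_ , q))
  r a (_ , T) = T , T
  r a (_ , F) = F , F
  r a (_ , cond p b q) =
    if does (b ≟ a) then r a (_ , q) else condᵇ (r a (_ , p)) b (r a (_ , q))

  depth-ℓ : ∀ a P → depthᵇ (ℓ a P) ≤ depthᵇ P
  depth-ℓ a (_ , T) = z≤n
  depth-ℓ a (_ , F) = z≤n
  depth-ℓ a (_ , cond p b q) = depthᵇ-if (does (b ≟ a))
    (ℕ.m≤n⇒m≤1+n (ℕ.m≤n⇒m≤n⊔o (depthᵇ (_ , q)) (depth-ℓ a (_ , p))))
    (s≤s (ℕ.⊔-mono-≤ (depth-ℓ a (_ , p)) (depth-ℓ a (_ , q))))

  depth-r : ∀ a P → depthᵇ (r a P) ≤ depthᵇ P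
  depth-r a (_ , T) = z≤n
  depth-r a (_ , F) = z≤n
  depth-r a (_ , cond p b q) = depthᵇ-if (does (b ≟ a))
    (ℕ.m≤n⇒m≤1+n (ℕ.m≤n⇒m≤o⊔n (depthᵇ (_ , p)) (depth-r a (_ , q))))
    (s≤s (ℕ.⊔-mono-≤ (depth-r a (_ , p)) (depth-r a (_ , q))))

  -- Same scheme as m-bounded; mf-cond is the intended defining equation.
  mf-bounded : ∀ n (P : BF A) → depthᵇ P ≤ n → BF A
  mf-bounded _       (_ , T)          _       = T , T
  mf-bounded _       (_ , F)          _       = F , F
  mf-bounded (suc n) (_ , cond p a q) (s≤s h) = condᵇ
    (mf-bounded n (ℓ a (_ , p))
      (ℕ.≤-trans (depth-ℓ a (_ , p)) (ℕ.m⊔n≤o⇒m≤o (depthᵇ (_ , p)) (depthᵇ (_ , q)) h)))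
    a
    (mf-bounded n (r a (_ , q))
      (ℕ.≤-trans (depth-r a (_ , q)) (ℕ.m⊔n≤o⇒n≤o (depthᵇ (_ , p)) (depthᵇ (_ , q)) h)))

  mf : BF A → BF A
  mf P = mf-bounded (depthᵇ P) P ℕ.≤-refl

  mf-bounded-irr : ∀ n n′ P h h′ → mf-bounded n P h ≡ mf-bounded n′ P h′
  mf-bounded-irr _       _        (_ , T)          _       _       = refl
  mf-bounded-irr _       _        (_ , F)          _       _       = refl
  mf-bounded-irr (suc n) (suc n′) (_ , cond p a q) (s≤s _) (s≤s _) =
    cong₂ (λ P Q → condᵇ P a Q)
      (mf-bounded-irr n n′ (ℓ a (_ , p)) _ _) (mf-bounded-irr n n′ (r a (_ , q)) _ _)

  mf-cond : ∀ P a Q → mf (condᵇ P a Q) ≡ condᵇ (mf (ℓ a P)) a (mf (r a Q))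
  mf-cond P a Q =
    cong₂ (λ P Q → condᵇ P a Q)
      (mf-bounded-irr _ _ (ℓ a P) _ _) (mf-bounded-irr _ _ (r a Q) _ _)

  mbf : Term A → BF A
  mbf P = mf (bf P)

  infix 4 _=mse_ _=mbf_

  _=mse_ : Term A → Term A → Set ℓ₀
  P =mse Q = mse P ≡ mse Q

  -- Syntactic equality of the underlying terms.
  _=mbf_ : Term A → Term A → Set ℓ₀
  P =mbf Q = proj₁ (mbf P) ≡ proj₁ (mbf Q)

{-# OPTIONS --safe #-}
-- On basic forms se is injective, with the evident embedding of trees into terms
-- as left inverse, and it carries leaf replacement, ℓ, r and mf to leaf
-- replacement, L, R and m.  Hence mse P = se (mbf P).
module Submission where

open import Level using (Level)
open import Data.Nat using (suc; s≤s)
import Data.Nat.Properties as ℕ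
open import Data.Product using (∃₂; _,_; proj₁)
open import Function.Bundles using (_⇔_; mk⇔)
open import Relation.Binary.Definitions using (DecidableEquality)
open import Relation.Binary.PropositionalEquality
  using (_≡_; _≢_; refl; sym; trans; cong; cong₂; module ≡-Reasoning)
open import Relation.Nullary using (yes; no)
open import Defs

private
  variable
    ℓ₀ : Level
    A  : Set ℓ₀

-- se (P ◁ atom a ▷ Q) reduces to se P ⊴ a ⊵ se Q.
seᵇ : BF A → Tree A
seᵇ P = se (proj₁ P)

toTerm : Tree A → Term A
toTerm T           = T
toTerm F           = F
toTerm (X ⊴ a ⊵ Y) = toTerm X ◁ atom a ▷ toTerm Y

-- Every condition in a basic form is an atom, so `se` copies its shape node by node. This fails for
-- general terms: `atom a` and `T ◁ atom a ▷ F` have the same tree.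
toTerm-seᵇ : (P : BF A) → toTerm (seᵇ P) ≡ proj₁ P
toTerm-seᵇ (_ , T)          = refl
toTerm-seᵇ (_ , F)          = refl
toTerm-seᵇ (_ , cond p a q) =
  cong₂ (_◁ atom a ▷_) (toTerm-seᵇ (_ , p)) (toTerm-seᵇ (_ , q))

seᵇ-injective : (P Q : BF A) → seᵇ P ≡ seᵇ Q → proj₁ P ≡ proj₁ Q
seᵇ-injective P Q eq =
  trans (sym (toTerm-seᵇ P)) (trans (cong toTerm eq) (toTerm-seᵇ Q))

seᵇ-replace : (P Q R : BF A) →
              seᵇ (P [T↦ Q ,F↦ R ]ᵇ) ≡ seᵇ P [T↦ seᵇ Q ,F↦ seᵇ R ]
seᵇ-replace (_ , T)          Q R = refl
seᵇ-replace (_ , F)          Q R = refl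
seᵇ-replace (_ , cond p a q) Q R =
  cong₂ (_⊴ a ⊵_) (seᵇ-replace (_ , p) Q R) (seᵇ-replace (_ , q) Q R)

-- `bf` and `se` follow the same recursion, and `seᵇ-replace` matches their replacement steps.
seᵇ-bf : (P : Term A) → seᵇ (bf P) ≡ se P
seᵇ-bf T           = refl
seᵇ-bf F           = refl
seᵇ-bf (atom a)    = refl
seᵇ-bf (P ◁ Q ▷ R) = begin
  seᵇ (bf Q [T↦ bf P ,F↦ bf R ]ᵇ)                ≡⟨ seᵇ-replace (bf Q) (bf P) (bf R) ⟩
  seᵇ (bf Q) [T↦ seᵇ (bf P) ,F↦ seᵇ (bf R) ]     ≡⟨ cong (_[T↦ _ ,F↦ _ ]) (seᵇ-bf Q) ⟩
  se Q [T↦ seᵇ (bf P) ,F↦ seᵇ (bf R) ]           ≡⟨ cong₂ (se Q [T↦_,F↦_]) (seᵇ-bf P) (seᵇ-bf R) ⟩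
  se Q [T↦ se P ,F↦ se R ]                       ∎
  where open ≡-Reasoning

module _ {A : Set ℓ₀} (_≟_ : DecidableEquality A) where
  open Memorizing _≟_

  seᵇ-ℓ : ∀ a {P} (p : IsBF P) → seᵇ (ℓ a (P , p)) ≡ L a (se P)
  seᵇ-ℓ a T = refl
  seᵇ-ℓ a F = refl
  seᵇ-ℓ a (cond p b q) with b ≟ a
  ... | yes _ = seᵇ-ℓ a p
  ... | no  _ = cong₂ (_⊴ b ⊵_) (seᵇ-ℓ a p) (seᵇ-ℓ a q)

  seᵇ-r : ∀ a {P} (p : IsBF P) → seᵇ (r a (P , p)) ≡ R a (se P)
  seᵇ-r a T = refl
  seᵇ-r a F = refl
  seᵇ-r a (cond p b q) with b ≟ a
  ... | yes _ = seᵇ-r a q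
  ... | no  _ = cong₂ (_⊴ b ⊵_) (seᵇ-r a p) (seᵇ-r a q)

  -- The tree is a separate variable X so that the induction hypothesis applies
  -- to L a _ and R a _ without transporting the depth bound.
  seᵇ-mf-bounded : ∀ n n′ P {X} h h′ → seᵇ P ≡ X →
                   seᵇ (mf-bounded n P h) ≡ m-bounded n′ X h′
  seᵇ-mf-bounded _       _        (_ , T)          _       _       refl = refl
  seᵇ-mf-bounded _       _        (_ , F)          _       _       refl = refl
  -- `refl` exposes `X` as a node, so both depths are successors and neither bound can be zero.
  seᵇ-mf-bounded (suc n) (suc n′) (_ , cond p a q) (s≤s _) (s≤s _) refl =
    cong₂ (_⊴ a ⊵_)
      (seᵇ-mf-bounded n n′ (ℓ a (_ , p)) _ _ (seᵇ-ℓ a p))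
      (seᵇ-mf-bounded n n′ (r a (_ , q)) _ _ (seᵇ-r a q))

  seᵇ-mbf : ∀ P → seᵇ (mbf P) ≡ mse P
  -- The two bounds, the depths of `bf P` and `se P`, are independent, so they never have to be
  -- compared.
  seᵇ-mbf P = seᵇ-mf-bounded _ _ (bf P) ℕ.≤-refl ℕ.≤-refl (seᵇ-bf P)

proposition5p13 : ∀ {a} {A : Set a} (countable : Countable A) →
    (∃₂ λ (x y : A) → x ≢ y) →
    let open Memorizing (atom-≟ countable) in
    (P Q : Term A) → (P =mse Q) ⇔ (P =mbf Q)
proposition5p13 countable _ P Q = mk⇔
  -- Injectivity enters only in this direction; the converse applies `se` to equal terms.
  (λ eq → seᵇ-injective (mbf P) (mbf Q) (trans (mbf≡mse P) (trans eq (sym (mbf≡mse Q)))))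
  (λ eq → trans (sym (mbf≡mse P)) (trans (cong se eq) (mbf≡mse Q)))
  where
  open Memorizing (atom-≟ countable)
  mbf≡mse = seᵇ-mbf (atom-≟ countable)
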